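{- Let $G$ be a 3-colorable, co-bridge-free, prismatic graph. Then $\Lambda(G)\le 5$, or $G$ is a Schl\"afli-prismatic graph.
   Context: A triangle is a set of three pairwise adjacent vertices. A graph $G$ is prismatic if for every triangle $T$ of $G$, every vertex not in $T$ has exactly one neighbor in $T$. The co-bridge is $C_4+2K_1$ (disjoint union of a 4-cycle and two isolated vertices); co-bridge-free means no induced co-bridge. 3-colorable means $V(G)$ can be partitioned into three stable sets. A hitting set of $G$ is a set of vertices meeting every triangle; $\Lambda(G)$ is the minimum size of a hitting set. The complement of the Schl\"afli graph has 27 vertices $r^i_j,s^i_j,t^i_j$ ($1\le i,j\le 3$); for $1\le i,i',j,j'\le3$: if $i\ne i'$ and $j\ne j'$ then $r^i_jr^{i'}_{j'}$, $s^i_js^{i'}_{j'}$, $t^i_jt^{i'}_{j'}$ are edges; if $j=i'$ then $r^i_js^{i'}_{j'}$, $s^i_jt^{i'}_{j'}$, $t^i_jr^{i'}_{j'}$ are edges; no other edges. A Schl\"afli-prismatic graph is a graph isomorphic to an induced subgraph of the complement of the Schl\"afli graph. -}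

module Defs where

open import Data.Nat using (ℕ; _≤_; _+_)
open import Data.Bool using (Bool; true; false; _∧_; _∨_; if_then_else_)
open import Data.Fin using (Fin; zero; suc; _≟_)
open import Data.Fin.Subset using (Subset; _∈_; ∣_∣)
open import Data.Product using (Σ; _×_; _,_; ∃; ∃-syntax)
open import Data.Sum using (_⊎_)
open import Relation.Nullary using (¬_)
open import Relation.Nullary.Decidable using (⌊_⌋)
open import Relation.Binary.PropositionalEquality using (_≡_; _≢_)
open import Function.Definitions using (Injective)

record Graph (n : ℕ) : Set where
  field
    adj    : Fin n → Fin n → Bool
    sym    : ∀ u v → adj u v ≡ adj v u
    irrefl : ∀ v → adj v v ≡ false

open Graph public

module _ {n : ℕ} (G : Graph n) where

  Adj : Fin n → Fin n → Set
  Adj u v = adj G u v ≡ true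

  -- a triangle: three pairwise adjacent vertices (distinct by irreflexivity)
  IsTriangle : Fin n → Fin n → Fin n → Set
  IsTriangle a b c = Adj a b × Adj b c × Adj a c

  b2n : Bool → ℕ
  b2n true  = 1
  b2n false = 0

  nbrsIn : Fin n → Fin n → Fin n → Fin n → ℕ
  nbrsIn v a b c = b2n (adj G v a) + b2n (adj G v b) + b2n (adj G v c)

  Prismatic : Set
  Prismatic = ∀ a b c → IsTriangle a b c → ∀ v →
              v ≢ a → v ≢ b → v ≢ c → nbrsIn v a b c ≡ 1

  ThreeColorable : Set
  ThreeColorable = Σ (Fin n → Fin 3) λ col → ∀ u v → Adj u v → col u ≢ col v

  IsHittingSet : Subset n → Set
  IsHittingSet H = ∀ a b c → IsTriangle a b c → (a ∈ H) ⊎ (b ∈ H) ⊎ (c ∈ H)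

  ΛAtMost : ℕ → Set
  ΛAtMost k = Σ (Subset n) λ H → IsHittingSet H × ∣ H ∣ ≤ k

-- The co-bridge C₄ + 2K₁ on Fin 6: 4-cycle 0-1-2-3-0, vertices 4 and 5 isolated.
coBridgeAdj : Fin 6 → Fin 6 → Bool
coBridgeAdj zero (suc zero) = true
coBridgeAdj (suc zero) zero = true
coBridgeAdj (suc zero) (suc (suc zero)) = true
coBridgeAdj (suc (suc zero)) (suc zero) = true
coBridgeAdj (suc (suc zero)) (suc (suc (suc zero))) = true
coBridgeAdj (suc (suc (suc zero))) (suc (suc zero)) = true
coBridgeAdj (suc (suc (suc zero))) zero = true
coBridgeAdj zero (suc (suc (suc zero))) = true
coBridgeAdj _ _ = false

HasInducedCoBridge : {n : ℕ} → Graph n → Set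
HasInducedCoBridge G =
  Σ (Fin 6 → _) λ f → Injective _≡_ _≡_ f × (∀ i j → adj G (f i) (f j) ≡ coBridgeAdj i j)

CoBridgeFree : {n : ℕ} → Graph n → Set
CoBridgeFree G = ¬ HasInducedCoBridge G

-- Complement of the Schläfli graph.  A vertex is (k , i , j) with
-- k ∈ {0,1,2} standing for r, s, t respectively, and i, j the indices
-- (0-based, i.e. index i+1 in the paper) of r^i_j, s^i_j, t^i_j.
SchV : Set
SchV = Fin 3 × Fin 3 × Fin 3

next3 : Fin 3 → Fin 3
next3 zero = suc zero
next3 (suc zero) = suc (suc zero)
next3 (suc (suc zero)) = zero

eqb : Fin 3 → Fin 3 → Bool
eqb x y = ⌊ x ≟ y ⌋

notb : Bool → Bool
notb true = false
notb false = true

crossRule : SchV → SchV → Bool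
crossRule (k , i , j) (k' , i' , j') = eqb k' (next3 k) ∧ eqb j i'

schAdj : SchV → SchV → Bool
schAdj (k , i , j) (k' , i' , j') =
  (eqb k k' ∧ notb (eqb i i') ∧ notb (eqb j j'))
  ∨ crossRule (k , i , j) (k' , i' , j')
  ∨ crossRule (k' , i' , j') (k , i , j)

SchlafliPrismatic : {n : ℕ} → Graph n → Set
SchlafliPrismatic {n} G =
  Σ (Fin n → SchV) λ f → Injective _≡_ _≡_ f × (∀ u v → adj G u v ≡ schAdj (f u) (f v))

{-# OPTIONS --safe #-}
module Submission where

-- Suppose no five vertices hit all triangles, and let F be an induced subgraph
-- of G all of whose triangles are hit by a set H of at most five vertices of F.
-- Some triangle of G avoids H, so F grows by that triangle; since a vertex has
-- exactly one neighbour in each triangle of F, it has few possible adjacencies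
-- to F, and most of them create a co-bridge.  With H well chosen, this growth
-- starting from the empty graph meets only nineteen configurations up to
-- symmetry before it stops at C₁₁, the subgraph of the Schläfli complement
-- induced by all r and s.  C₁₁ needs six vertices to hit its triangles, but every
-- vertex outside it would create a co-bridge, so then G is C₁₁.  The
-- configurations and the sets H were found by computer search.

open import Defs hiding (sym)
open import Data.Nat using (ℕ; zero; suc; _+_; _∸_; _≤_; _≤?_; z≤n; s≤s)
import Data.Nat as ℕ
import Data.Nat.Properties as ℕ
open import Data.Bool using (Bool; true; false)
import Data.Bool as Bool
open import Data.Empty using (⊥; ⊥-elim)
open import Data.Unit using (⊤; tt)
open import Data.Fin using (Fin; zero; suc; fromℕ<)
import Data.Fin as Fin
import Data.Fin.Properties as Fin
open import Data.Fin.Patterns using (0F; 1F; 2F)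
open import Data.Fin.Subset using (Subset; ⁅_⁆; _∪_; ⋃; ∣_∣; inside; outside)
import Data.Fin.Subset as Subset
import Data.Fin.Subset.Properties as Subset
open import Data.Fin.Subset.Properties using (x∈⁅x⁆; ∣⁅x⁆∣≡1; x∈p∪q⁺; ∣⊥∣≡0)
open import Data.List using (List; []; _∷_; filter; concatMap; allFin; length)
import Data.List as List
open import Data.List.Membership.Propositional using () renaming (_∈_ to _∈ˡ_)
open import Data.List.Membership.Propositional.Properties using (∈-filter⁺; ∈-map⁺; ∈-allFin; ∈-concatMap⁺)
open import Data.List.Properties using (length-map)
import Data.List.Membership.DecPropositional as DecMembership
open import Data.List.Relation.Unary.All using (All; []; _∷_)
import Data.List.Relation.Unary.All as All
open import Data.List.Relation.Unary.Any using (Any; here; there)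
import Data.List.Relation.Unary.Any as Any
open import Data.Product using (∃; _×_; _,_; proj₁; proj₂)
open import Data.Product.Properties using (≡-dec)
open import Data.Sum using (_⊎_; inj₁; inj₂)
open import Data.Vec using (Vec; []; _∷_; lookup; tabulate)
import Data.Vec as Vec
open import Data.Vec.Properties using (lookup∘tabulate)
open import Data.Vec.Functional using () renaming (_∷_ to _◂_)
open import Data.Vec.Relation.Unary.All using ([]; _∷_) renaming (All to Allⱽ)
open import Data.Vec.Relation.Unary.AllPairs using (AllPairs; []; _∷_)
open import Data.Vec.Relation.Binary.Pointwise.Inductive using (Pointwise; []; _∷_)
open import Function using (_∘_; case_of_)
open import Relation.Nullary using (¬_; Dec; yes; no; does; contradiction)
open import Relation.Nullary.Decidable using (True; toWitness; ¬?; _×-dec_; _⊎-dec_; _→-dec_; decidable-stable)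
open import Relation.Binary.PropositionalEquality using (_≡_; _≢_; refl; sym; trans; cong; cong₂; subst)

-- Coloured configurations and their one-vertex extensions.

private
  variable
    m k : ℕ

Colour : Set
Colour = Fin 3

infixl 5 _▹[_]_

-- A coloured graph built vertex by vertex: each new vertex comes with its
-- colour and its adjacencies to the older ones.  Index 0 is the newest vertex.
data Config : ℕ → Set where
  ∅      : Config 0
  _▹[_]_ : Config m → Colour → Vec Bool m → Config (suc m)

edge : Config m → Fin m → Fin m → Bool
edge (F ▹[ _ ] w) zero    zero    = false
edge (F ▹[ _ ] w) zero    (suc j) = lookup w j
edge (F ▹[ _ ] w) (suc i) zero    = lookup w i
edge (F ▹[ _ ] w) (suc i) (suc j) = edge F i j

colour : Config m → Fin m → Colour
colour (F ▹[ c ] _) zero    = c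
colour (F ▹[ _ ] _) (suc i) = colour F i

-- In the tables below vertices are named by age (0 is the oldest), so that
-- names survive extension; too large an age denotes the newest vertex.
vertex : ℕ → Fin (suc m)
vertex {m} a = fromℕ< (s≤s (ℕ.m∸n≤m m a))

joined : List ℕ → Vec Bool m
joined {zero}  _  = []
joined {suc m} as = does (m ∈? as) ∷ joined as
  where open DecMembership ℕ._≟_ using (_∈?_)

weight : Bool → ℕ
weight true  = 1
weight false = 0

ExactlyOne : Bool → Bool → Bool → Set
ExactlyOne x y z = weight x + weight y + weight z ≡ 1

-- Only the newest vertex and the triangles through it are tested; older triangles were already
-- tested when `rows` handled the shorter prefix.
Fits : Config m → Colour → Vec Bool m → Set
Fits ∅            c []      = ⊤
Fits (F ▹[ d ] w) c (b ∷ v) =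
  (c ≡ d → b ≡ false) ×
  (∀ i → lookup w i ≡ true → ∀ j → lookup w j ≡ true → edge F i j ≡ true →
   ExactlyOne b (lookup v i) (lookup v j))

fits? : (F : Config m) → ∀ c v → Dec (Fits F c v)
fits? ∅            c []      = yes tt
fits? (F ▹[ d ] w) c (b ∷ v) =
  (c Fin.≟ d →-dec b Bool.≟ false) ×-dec
  Fin.all? λ i → lookup w i Bool.≟ true →-dec
  Fin.all? λ j → lookup w j Bool.≟ true →-dec (edge F i j Bool.≟ true →-dec (_ ℕ.≟ 1))

-- All adjacency rows to F that a further vertex of colour c can have, as far as
-- the triangles of F can tell.
rows : Config m → Colour → List (Vec Bool m)
rows ∅              c = [] ∷ []
rows F@(F′ ▹[ _ ] _) c =
  concatMap (λ v → filter (fits? F c) ((false ∷ v) ∷ (true ∷ v) ∷ [])) (rows F′ c)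

-- Complements `Fits`: there a new vertex is tested against old triangles, here old vertices are
-- tested against the triangles that the new vertex creates.
NewestPrismatic : Config (suc m) → Set
NewestPrismatic (F ▹[ _ ] w) =
  ∀ i → lookup w i ≡ true → ∀ j → lookup w j ≡ true → edge F i j ≡ true →
  ∀ l → l ≢ i → l ≢ j → ExactlyOne (lookup w l) (edge F l i) (edge F l j)

newestPrismatic? : (F : Config (suc m)) → Dec (NewestPrismatic F)
newestPrismatic? (F ▹[ _ ] w) =
  Fin.all? λ i → lookup w i Bool.≟ true →-dec
  Fin.all? λ j → lookup w j Bool.≟ true →-dec (edge F i j Bool.≟ true →-dec
  Fin.all? λ l → ¬? (l Fin.≟ i) →-dec (¬? (l Fin.≟ j) →-dec (_ ℕ.≟ 1)))

-- Ages that are too large collapse onto the newest vertex; the injectivity clause keeps such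
-- collapsed vertices from passing as a copy.
Matches : Config m → (Fin k → Fin m) → (Fin k → Fin k → Bool) → Set
Matches F μ e = ∀ i j → edge F (μ i) (μ j) ≡ e i j × (μ i ≡ μ j → i ≡ j)

matches? : (F : Config m) (μ : Fin k → Fin m) → ∀ e → Dec (Matches F μ e)
matches? F μ e = Fin.all? λ i → Fin.all? λ j →
  (edge F (μ i) (μ j) Bool.≟ e i j) ×-dec (μ i Fin.≟ μ j →-dec i Fin.≟ j)

-- Candidates for a vertex: old vertices, or a new one given by its colour and row.
record Pool (m : ℕ) : Set where
  constructor pool
  field
    hue  : Colour
    olds : List (Fin m)
    news : List (Vec Bool m)

near : Config m → Fin m → Pool m → Pool m
near F i (pool c is ws) =
  pool c (filter (λ j → edge F j i Bool.≟ true) is) (filter (λ w → lookup w i Bool.≟ true) ws)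

-- While `near` narrows the pools after an old corner is chosen, this does so after a new corner is
-- added: old indices shift by one, and new rows gain `true` for the edge to that corner.
beside : Config m → Colour → Vec Bool m → Pool m → Pool (suc m)
beside F d v (pool c is ws) =
  pool c (List.map suc (filter (λ j → lookup v j Bool.≟ true) is))
         (filter (fits? (F ▹[ d ] v) c) (List.map (true ∷_) ws))

-- Vertex lists as hitting sets.

∣p∪q∣≤∣p∣+∣q∣ : (p q : Subset m) → ∣ p ∪ q ∣ ≤ ∣ p ∣ + ∣ q ∣
∣p∪q∣≤∣p∣+∣q∣ []            []            = z≤n
∣p∪q∣≤∣p∣+∣q∣ (outside ∷ p) (outside ∷ q) = ∣p∪q∣≤∣p∣+∣q∣ p q
∣p∪q∣≤∣p∣+∣q∣ (outside ∷ p) (inside  ∷ q) =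
  ℕ.≤-trans (s≤s (∣p∪q∣≤∣p∣+∣q∣ p q)) (ℕ.≤-reflexive (sym (ℕ.+-suc ∣ p ∣ ∣ q ∣)))
∣p∪q∣≤∣p∣+∣q∣ (inside  ∷ p) (outside ∷ q) = s≤s (∣p∪q∣≤∣p∣+∣q∣ p q)
∣p∪q∣≤∣p∣+∣q∣ (inside  ∷ p) (inside  ∷ q) =
  s≤s (ℕ.≤-trans (∣p∪q∣≤∣p∣+∣q∣ p q) (ℕ.+-monoʳ-≤ ∣ p ∣ (ℕ.n≤1+n ∣ q ∣)))

fromList : List (Fin m) → Subset m
fromList = ⋃ ∘ List.map ⁅_⁆

∈-fromList : ∀ {x : Fin m} {xs} → x ∈ˡ xs → x Subset.∈ fromList xs
∈-fromList (here refl)  = x∈p∪q⁺ (inj₁ (x∈⁅x⁆ _))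
∈-fromList (there x∈xs) = x∈p∪q⁺ (inj₂ (∈-fromList x∈xs))

∣fromList∣≤length : (xs : List (Fin m)) → ∣ fromList xs ∣ ≤ length xs
∣fromList∣≤length {m} []       = ℕ.≤-reflexive (∣⊥∣≡0 m)
∣fromList∣≤length     (x ∷ xs) = ℕ.≤-trans (∣p∪q∣≤∣p∣+∣q∣ ⁅ x ⁆ (fromList xs))
  (ℕ.+-mono-≤ (ℕ.≤-reflexive (∣⁅x⁆∣≡1 x)) (∣fromList∣≤length xs))

-- The nineteen configurations.

C₁ : Config 3
C₁ = ∅
  ▹[ 0F ] joined []
  ▹[ 1F ] joined (0 ∷ [])
  ▹[ 2F ] joined (0 ∷ 1 ∷ [])

-- The prism: prismaticity joins two disjoint triangles by a perfect matching, and a proper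
-- colouring makes it a cyclic shift of the colours.
C₂ : Config 6
C₂ = C₁
  ▹[ 0F ] joined (2 ∷ [])
  ▹[ 1F ] joined (0 ∷ 3 ∷ [])
  ▹[ 2F ] joined (1 ∷ 3 ∷ 4 ∷ [])

C₃ : Config 8
C₃ = C₂
  ▹[ 0F ] joined (2 ∷ 4 ∷ [])
  ▹[ 1F ] joined (2 ∷ 5 ∷ 6 ∷ [])

C₄ : Config 10
C₄ = C₃
  ▹[ 0F ] joined (1 ∷ 4 ∷ 7 ∷ [])
  ▹[ 2F ] joined (0 ∷ 3 ∷ 7 ∷ 8 ∷ [])

C₅ : Config 12
C₅ = C₄
  ▹[ 0F ] joined (2 ∷ 4 ∷ 9 ∷ [])
  ▹[ 1F ] joined (2 ∷ 5 ∷ 8 ∷ 10 ∷ [])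

C₆ : Config 12
C₆ = C₄
  ▹[ 0F ] joined (2 ∷ 4 ∷ 9 ∷ [])
  ▹[ 2F ] joined (1 ∷ 4 ∷ 7 ∷ 10 ∷ [])

C₇ : Config 14
C₇ = C₆
  ▹[ 0F ] joined (2 ∷ 5 ∷ 9 ∷ 11 ∷ [])
  ▹[ 1F ] joined (0 ∷ 3 ∷ 6 ∷ 8 ∷ 11 ∷ 12 ∷ [])

C₈ : Config 15
C₈ = C₇
  ▹[ 1F ] joined (0 ∷ 5 ∷ 6 ∷ 8 ∷ 10 ∷ 12 ∷ [])

C₉ : Config 16
C₉ = C₈
  ▹[ 2F ] joined (1 ∷ 3 ∷ 7 ∷ 10 ∷ 13 ∷ 14 ∷ [])

C₁₀ : Config 17
C₁₀ = C₉
  ▹[ 1F ] joined (0 ∷ 5 ∷ 6 ∷ 9 ∷ 11 ∷ 15 ∷ [])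

C₁₁ : Config 18
C₁₁ = C₁₀
  ▹[ 2F ] joined (1 ∷ 3 ∷ 6 ∷ 8 ∷ 10 ∷ 12 ∷ 16 ∷ [])

C₁₂ : Config 12
C₁₂ = C₄
  ▹[ 0F ] joined (1 ∷ 4 ∷ 7 ∷ [])
  ▹[ 2F ] joined (0 ∷ 3 ∷ 7 ∷ 10 ∷ [])

C₁₃ : Config 13
C₁₃ = C₄
  ▹[ 0F ] joined (2 ∷ 5 ∷ 9 ∷ [])
  ▹[ 1F ] joined (0 ∷ 3 ∷ 6 ∷ 8 ∷ 10 ∷ [])
  ▹[ 2F ] joined (1 ∷ 4 ∷ 7 ∷ 10 ∷ 11 ∷ [])

C₁₄ : Config 13
C₁₄ = C₄
  ▹[ 0F ] joined (1 ∷ 4 ∷ 7 ∷ [])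
  ▹[ 1F ] joined (2 ∷ 5 ∷ 9 ∷ 10 ∷ [])
  ▹[ 2F ] joined (0 ∷ 3 ∷ 6 ∷ 8 ∷ 10 ∷ 11 ∷ [])

C₁₅ : Config 11
C₁₅ = C₃
  ▹[ 0F ] joined (2 ∷ 4 ∷ [])
  ▹[ 1F ] joined (0 ∷ 5 ∷ 6 ∷ 8 ∷ [])
  ▹[ 2F ] joined (1 ∷ 3 ∷ 7 ∷ 8 ∷ 9 ∷ [])

C₁₆ : Config 11
C₁₆ = C₃
  ▹[ 0F ] joined (1 ∷ 4 ∷ 7 ∷ [])
  ▹[ 1F ] joined (2 ∷ 5 ∷ 8 ∷ [])
  ▹[ 2F ] joined (0 ∷ 3 ∷ 6 ∷ 8 ∷ 9 ∷ [])

-- Orienting each pair of disjoint triangles by its colour shift gives a tournament. It is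
-- transitive here on three triangles, and in `C₁₈` on four.
C₁₇ : Config 9
C₁₇ = C₂
  ▹[ 0F ] joined (2 ∷ 4 ∷ [])
  ▹[ 1F ] joined (0 ∷ 5 ∷ 6 ∷ [])
  ▹[ 2F ] joined (1 ∷ 3 ∷ 6 ∷ 7 ∷ [])

C₁₈ : Config 12
C₁₈ = C₁₇
  ▹[ 0F ] joined (1 ∷ 4 ∷ 7 ∷ [])
  ▹[ 1F ] joined (2 ∷ 5 ∷ 8 ∷ 9 ∷ [])
  ▹[ 2F ] joined (0 ∷ 3 ∷ 6 ∷ 9 ∷ 10 ∷ [])

-- The cyclic tournament, whose shifts close up into three more triangles: the 3 by 3 rook's graph.
C₁₉ : Config 9
C₁₉ = C₂
  ▹[ 0F ] joined (1 ∷ 5 ∷ [])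
  ▹[ 1F ] joined (2 ∷ 3 ∷ 6 ∷ [])
  ▹[ 2F ] joined (0 ∷ 4 ∷ 6 ∷ 7 ∷ [])

-- Configurations inside the given graph.

module _ {n : ℕ} (G : Graph n) (coBridgeFree : CoBridgeFree G) (prismatic : Prismatic G) where

  Conclusion : Set
  Conclusion = ΛAtMost G 5 ⊎ SchlafliPrismatic G

  Proper : (Fin n → Colour) → Set
  Proper col = ∀ u v → Adj G u v → col u ≢ col v

  irreflexive : ∀ {u v} → Adj G u v → u ≢ v
  irreflexive {u} u~u refl = case trans (sym u~u) (irrefl G u) of λ ()

  symmetric : ∀ {u v} → Adj G u v → Adj G v u
  symmetric {u} {v} u~v = trans (Graph.sym G v u) u~v

  exactlyOne : ∀ {a b c v} → IsTriangle G a b c → v ≢ a → v ≢ b → v ≢ c →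
               ExactlyOne (adj G v a) (adj G v b) (adj G v c)
  exactlyOne {a} {b} {c} {v} t v≢a v≢b v≢c =
    trans (sym (cong₂ _+_ (cong₂ _+_ (b2n≡weight (adj G v a)) (b2n≡weight (adj G v b)))
                          (b2n≡weight (adj G v c))))
          (prismatic a b c t v v≢a v≢b v≢c)
    where
    b2n≡weight : ∀ x → b2n G x ≡ weight x
    b2n≡weight true  = refl
    b2n≡weight false = refl

  row : (Fin m → Fin n) → Fin n → Vec Bool m
  row ρ v = tabulate (adj G v ∘ ρ)

  record Embedding (col : Fin n → Colour) (F : Config m) (ρ : Fin m → Fin n) : Set where
    field
      injective : ∀ {i j} → ρ i ≡ ρ j → i ≡ j
      edges     : ∀ i j → adj G (ρ i) (ρ j) ≡ edge F i j
      colours   : ∀ i → col (ρ i) ≡ colour F i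

  open Embedding

  -- The colouring is not fixed, so that a settled configuration can be applied again after its
  -- colours are permuted.
  Settled : Config m → Set
  Settled F = ∀ {col} → Proper col → ∀ {ρ} → Embedding col F ρ → Conclusion

  module _ {col : Fin n → Colour} (proper : Proper col) where

    empty : Embedding col ∅ λ ()
    empty = record { injective = λ {i} → λ { _ → ⊥-elim (Fin.¬Fin0 i) } ; edges = λ () ; colours = λ () }

    extend : {F : Config m} {ρ : Fin m → Fin n} → Embedding col F ρ →
             ∀ {c v} → col v ≡ c → (∀ i → ρ i ≢ v) → Embedding col (F ▹[ c ] row ρ v) (v ◂ ρ)
    extend {ρ = ρ} E {v = v} v∶c v∉ρ = record
      { injective = inj
      ; edges     = λ where
          zero    zero    → irrefl G v
          zero    (suc j) → sym (lookup∘tabulate (adj G v ∘ ρ) j)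
          (suc i) zero    → trans (Graph.sym G (ρ i) v) (sym (lookup∘tabulate (adj G v ∘ ρ) i))
          (suc i) (suc j) → edges E i j
      ; colours   = λ where
          zero    → v∶c
          (suc i) → colours E i
      }
      where
      inj : ∀ {i j} → (v ◂ ρ) i ≡ (v ◂ ρ) j → i ≡ j
      inj {zero}  {zero}  _ = refl
      inj {zero}  {suc j} e = contradiction (sym e) (v∉ρ j)
      inj {suc i} {zero}  e = contradiction e (v∉ρ i)
      inj {suc i} {suc j} e = cong suc (injective E e)

    older : ∀ {F : Config m} {c w ρ} → Embedding col (F ▹[ c ] w) ρ → Embedding col F (ρ ∘ suc)
    older E = record
      { injective = Fin.suc-injective ∘ injective E
      ; edges     = λ i j → edges E (suc i) (suc j)
      ; colours   = colours E ∘ suc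
      }

    fits : {F : Config m} {ρ : Fin m → Fin n} → Embedding col F ρ →
           ∀ {c v} → col v ≡ c → (∀ i → ρ i ≢ v) → Fits F c (row ρ v)
    fits {F = ∅}          E v∶c v∉ρ = tt
    fits {F = F ▹[ d ] w} {ρ} E {c} {v} v∶c v∉ρ = monochromatic , triangle
      where
      monochromatic : c ≡ d → adj G v (ρ zero) ≡ false
      monochromatic c≡d with adj G v (ρ zero) in e
      ... | false = refl
      ... | true  = contradiction (trans v∶c (trans c≡d (sym (colours E zero)))) (proper _ _ e)
      triangle : ∀ i → lookup w i ≡ true → ∀ j → lookup w j ≡ true → edge F i j ≡ true →
                 ExactlyOne _ (lookup (row (ρ ∘ suc) v) i) (lookup (row (ρ ∘ suc) v) j)
      triangle i wi j wj eij
        rewrite lookup∘tabulate (adj G v ∘ ρ ∘ suc) i | lookup∘tabulate (adj G v ∘ ρ ∘ suc) j =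
        exactlyOne (trans (edges E zero (suc i)) wi , trans (edges E (suc i) (suc j)) eij , trans (edges E zero (suc j)) wj)
                   (v∉ρ zero ∘ sym) (v∉ρ (suc i) ∘ sym) (v∉ρ (suc j) ∘ sym)

    row∈rows : {F : Config m} {ρ : Fin m → Fin n} → Embedding col F ρ →
               ∀ {c v} → col v ≡ c → (∀ i → ρ i ≢ v) → row ρ v ∈ˡ rows F c
    row∈rows {F = ∅}          E v∶c v∉ρ = here refl
    row∈rows {F = F ▹[ d ] w} {ρ} E {c} {v} v∶c v∉ρ =
      ∈-concatMap⁺ _ (Any.map (λ { refl → ∈-filter⁺ (fits? (F ▹[ d ] w) c) (bit _ _) (fits E v∶c v∉ρ) })
                              (row∈rows (older E) v∶c (v∉ρ ∘ suc)))
      where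
      bit : ∀ b (v : Vec Bool m) → (b ∷ v) ∈ˡ (false ∷ v) ∷ (true ∷ v) ∷ []
      bit false v = here refl
      bit true  v = there (here refl)

    newestPrismatic : ∀ {F : Config (suc m)} {ρ} → Embedding col F ρ → NewestPrismatic F
    newestPrismatic {F = F ▹[ _ ] w} {ρ} E i wi j wj eij l l≢i l≢j
      rewrite sym (edges E (suc l) zero) | sym (edges E (suc l) (suc i)) | sym (edges E (suc l) (suc j)) =
      exactlyOne (trans (edges E zero (suc i)) wi , trans (edges E (suc i) (suc j)) eij , trans (edges E zero (suc j)) wj)
                 (λ e → case injective E e of λ ()) (l≢i ∘ Fin.suc-injective ∘ injective E)
                 (l≢j ∘ Fin.suc-injective ∘ injective E)

  -- Reasons why a configuration is settled: it contains the co-bridge, or an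
  -- already settled configuration after renaming the colours by σ.  Vertices
  -- are listed by age.
  data Reason : Set where
    coBridge : Vec ℕ 6 → Reason
    contains : {K : Config k} → Settled K → Vec Colour 3 → Vec ℕ k → Reason

  unchanged : Vec Colour 3
  unchanged = 0F ∷ 1F ∷ 2F ∷ []

  extends : {K : Config k} → Settled K → Reason
  extends settled = contains settled unchanged (tabulate Fin.toℕ)

  place : Vec ℕ k → Fin k → Fin (suc m)
  place as i = vertex (lookup as i)

  Applies : Config (suc m) → Reason → Set
  Applies F (coBridge as)             = Matches F (place as) coBridgeAdj
  Applies F (contains {K = K} _ σ as) =
    Matches F μ (edge K) × (∀ i → lookup σ (colour F (μ i)) ≡ colour K i) ×
    (∀ c d → lookup σ c ≡ lookup σ d → c ≡ d)
    -- Lists of ages start with the oldest vertex, indices of `K` with the newest.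
    where μ = place (Vec.reverse as)

  applies? : (F : Config (suc m)) → ∀ r → Dec (Applies F r)
  applies? F (coBridge as)             = matches? F (place as) coBridgeAdj
  applies? F (contains {K = K} _ σ as) =
    matches? F μ (edge K) ×-dec Fin.all? (λ i → lookup σ (colour F (μ i)) Fin.≟ colour K i) ×-dec
    Fin.all? (λ c → Fin.all? λ d → lookup σ c Fin.≟ lookup σ d →-dec c Fin.≟ d)
    where μ = place (Vec.reverse as)

  Dead : List Reason → Config (suc m) → Set
  Dead rs F = Any (Applies F) rs ⊎ ¬ NewestPrismatic F

  dead? : ∀ rs → (F : Config (suc m)) → Dec (Dead rs F)
  dead? rs F = Any.any? (applies? F) rs ⊎-dec ¬? (newestPrismatic? F)

  -- A search tree over the corners of a triangle avoiding `H`. Using up the pools without a dead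
  -- configuration is failure, so with `trianglePools` a closed tree also certifies that `H` meets
  -- every triangle of the configuration.
  Closed : List Reason → Config m → Vec (Pool m) k → Set
  Closed rs F []                  = ⊥
  Closed rs F (pool c is ws ∷ ps) =
    All (λ i → Closed rs F (Vec.map (near F i) ps)) is ×
    All (λ w → Dead rs (F ▹[ c ] w) ⊎ Closed rs (F ▹[ c ] w) (Vec.map (beside F c w) ps)) ws

  closed? : ∀ rs (F : Config m) (ps : Vec (Pool m) k) → Dec (Closed rs F ps)
  closed? rs F []                  = no λ ()
  closed? rs F (pool c is ws ∷ ps) =
    All.all? (λ i → closed? rs F (Vec.map (near F i) ps)) is ×-dec
    All.all? (λ w → dead? rs (F ▹[ c ] w) ⊎-dec closed? rs (F ▹[ c ] w) (Vec.map (beside F c w) ps)) ws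

  -- Rows that are dead on their own are dropped in advance, since `candidate` draws the conclusion
  -- from such a vertex directly.
  avoiding : List Reason → Config m → List (Fin m) → Colour → Pool m
  avoiding rs F H c = pool c
    (filter (λ i → (colour F i Fin.≟ c) ×-dec ¬? (i ∈? H)) (allFin _))
    (filter (λ w → ¬? (dead? rs (F ▹[ c ] w))) (rows F c))
    where open DecMembership Fin._≟_ using (_∈?_)

  trianglePools : List Reason → Config m → List (Fin m) → Vec (Pool m) 3
  trianglePools rs F H = Vec.map (avoiding rs F H) (0F ∷ 1F ∷ 2F ∷ [])

  -- Soundness of the search.

  module _ {col : Fin n → Colour} (proper : Proper col) where

    dead-sound : ∀ {rs} {F : Config (suc m)} {ρ} → Dead rs F → Embedding col F ρ → Conclusion
    dead-sound (inj₂ ¬np) E = contradiction (newestPrismatic proper E) ¬np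
    dead-sound {F = F} {ρ} (inj₁ some) E = apply (proj₂ (Any.satisfied some))
      where
      apply : ∀ {r} → Applies F r → Conclusion
      apply {coBridge as} M = ⊥-elim (coBridgeFree
        ( ρ ∘ place as
        , (λ {i} {j} e → proj₂ (M i j) (injective E e))
        , λ i j → trans (edges E _ _) (proj₁ (M i j)) ))
      -- Composing the colouring with the injective `σ` keeps it proper, so `settled` applies to the
      -- renamed colouring.
      apply {contains settled σ as} (M , recolour , σ-injective) = settled
        {lookup σ ∘ col} (λ u v u~v e → proper u v u~v (σ-injective _ _ e))
        {ρ ∘ place (Vec.reverse as)} record
          { injective = λ {i} {j} e → proj₂ (M i j) (injective E e)
          ; edges     = λ i j → trans (edges E _ _) (proj₁ (M i j))
          ; colours   = λ i → trans (cong (lookup σ) (colours E _)) (recolour i)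
          }

    Candidate : (Fin m → Fin n) → Pool m → Fin n → Set
    Candidate ρ (pool c is ws) v =
      col v ≡ c × ((∃ λ i → i ∈ˡ is × ρ i ≡ v) ⊎ ((∀ i → ρ i ≢ v) × row ρ v ∈ˡ ws))

    near-candidate : ∀ {F : Config m} {ρ} → Embedding col F ρ → ∀ {i p u} → Adj G (ρ i) u →
                     Candidate ρ p u → Candidate ρ (near F i p) u
    near-candidate E {i} a (u∶c , inj₁ (j , j∈is , refl)) =
      u∶c , inj₁ (j , ∈-filter⁺ _ j∈is (trans (sym (edges E j i)) (symmetric a)) , refl)
    near-candidate {ρ = ρ} E {i} {u = u} a (u∶c , inj₂ (u∉ρ , row∈ws)) =
      u∶c , inj₂ (u∉ρ , ∈-filter⁺ _ row∈ws (trans (lookup∘tabulate (adj G u ∘ ρ) i) (symmetric a)))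

    beside-candidate : ∀ {F : Config m} {ρ} → Embedding col F ρ → ∀ {c v p u} →
                       col v ≡ c → (∀ i → ρ i ≢ v) → Adj G v u →
                       Candidate ρ p u → Candidate (v ◂ ρ) (beside F c (row ρ v) p) u
    beside-candidate {ρ = ρ} E {v = v} v∶c v∉ρ a (u∶d , inj₁ (j , j∈is , refl)) =
      u∶d , inj₁ (suc j , ∈-map⁺ suc (∈-filter⁺ _ j∈is (trans (lookup∘tabulate (adj G v ∘ ρ) j) a)) , refl)
    beside-candidate {F = F} {ρ} E {c} {v} {pool d _ ws} {u} v∶c v∉ρ a (u∶d , inj₂ (u∉ρ , row∈ws)) =
      u∶d , inj₂ (u∉v◂ρ , ∈-filter⁺ (fits? _ d) row∈ (fits proper (extend proper E v∶c v∉ρ) u∶d u∉v◂ρ))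
      where
      u∉v◂ρ : ∀ i → (v ◂ ρ) i ≢ u
      u∉v◂ρ zero    = irreflexive a
      u∉v◂ρ (suc i) = u∉ρ i
      row∈ : row (v ◂ ρ) u ∈ˡ List.map (true ∷_) ws
      row∈ = subst (λ b → (b ∷ row ρ u) ∈ˡ List.map (true ∷_) ws) (sym (symmetric a)) (∈-map⁺ (true ∷_) row∈ws)

    candidates-map : ∀ {ρ : Fin m → Fin n} {m′} {ρ′ : Fin m′ → Fin n} {f v} →
      (∀ {p u} → Adj G v u → Candidate ρ p u → Candidate ρ′ (f p) u) →
      {ps : Vec (Pool m) k} {us : Vec (Fin n) k} → Allⱽ (Adj G v) us →
      Pointwise (Candidate ρ) ps us → Pointwise (Candidate ρ′) (Vec.map f ps) us
    candidates-map g []       []       = []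
    candidates-map g (a ∷ as) (c ∷ cs) = g a c ∷ candidates-map g as cs

    -- Induction on the remaining corners: each actual corner selects a branch, and its adjacency to
    -- the others keeps them candidates in the narrowed pools.
    closed-sound : ∀ {rs} {F : Config m} {ρ} {ps : Vec (Pool m) k} {vs : Vec (Fin n) k} →
                   Closed rs F ps → Embedding col F ρ → AllPairs (Adj G) vs → Pointwise (Candidate ρ) ps vs → Conclusion
    closed-sound {ps = pool _ _ _ ∷ _} (close-old , _) E (as ∷ clique) ((v∶c , inj₁ (i , i∈is , refl)) ∷ cs) =
      closed-sound (All.lookup close-old i∈is) E clique (candidates-map (near-candidate E) as cs)
    closed-sound {ps = pool _ _ _ ∷ _} (_ , close-new) E (as ∷ clique) ((v∶c , inj₂ (v∉ρ , row∈ws)) ∷ cs)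
      with All.lookup close-new row∈ws
    ... | inj₁ dead   = dead-sound dead (extend proper E v∶c v∉ρ)
    ... | inj₂ closed = closed-sound closed (extend proper E v∶c v∉ρ) clique
                          (candidates-map (beside-candidate E v∶c v∉ρ) as cs)

    candidate : ∀ rs {F : Config m} {ρ} H → Embedding col F ρ → ∀ {c v} → col v ≡ c →
                v Subset.∉ fromList (List.map ρ H) → Conclusion ⊎ Candidate ρ (avoiding rs F H c) v
    candidate rs {F} {ρ} H E {c} {v} v∶c v∉H with Fin.any? (λ i → ρ i Fin.≟ v)
    ... | yes (i , refl) = inj₂ (v∶c , inj₁ (i , ∈-filter⁺ _ (∈-allFin i)
            (trans (sym (colours E i)) v∶c , v∉H ∘ ∈-fromList ∘ ∈-map⁺ ρ) , refl))
    ... | no v∉ρ with dead? rs (F ▹[ c ] row ρ v)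
    ...   | yes dead  = inj₁ (dead-sound dead (extend proper E v∶c λ i e → v∉ρ (i , e)))
    ...   | no  ¬dead = inj₂ (v∶c , inj₂ ((λ i e → v∉ρ (i , e)) ,
            ∈-filter⁺ _ (row∈rows proper E v∶c λ i e → v∉ρ (i , e)) ¬dead))

    -- Every triangle uses all three colours; ordering its corners by colour aligns them with
    -- `trianglePools`.
    Rainbow : Fin n → Fin n → Fin n → Set
    Rainbow x y z = (col x ≡ 0F × col y ≡ 1F × col z ≡ 2F) × IsTriangle G x y z

    rainbow? : ∀ x y z → Dec (Rainbow x y z)
    rainbow? x y z =
      ((col x Fin.≟ 0F) ×-dec (col y Fin.≟ 1F) ×-dec (col z Fin.≟ 2F)) ×-dec
      (adj G x y Bool.≟ true) ×-dec (adj G y z Bool.≟ true) ×-dec (adj G x z Bool.≟ true)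

    surjective : ∀ p q r → p ≢ q → q ≢ r → p ≢ r → ∀ (c : Colour) → p ≡ c ⊎ q ≡ c ⊎ r ≡ c
    surjective = toWitness {a? = Fin.all? λ p → Fin.all? λ q → Fin.all? λ r →
      ¬? (p Fin.≟ q) →-dec (¬? (q Fin.≟ r) →-dec (¬? (p Fin.≟ r) →-dec
      Fin.all? λ c → (p Fin.≟ c) ⊎-dec (q Fin.≟ c) ⊎-dec (r Fin.≟ c)))} tt

    sort : (P : Fin n → Set) → ∀ {a b c} → IsTriangle G a b c → P a → P b → P c →
           ∃ λ x → ∃ λ y → ∃ λ z → Rainbow x y z × P x × P y × P z
    sort P {a} {b} {c} (a~b , b~c , a~c) Pa Pb Pc =
      let x , x∶0 , x∈t = pick 0F
          y , y∶1 , y∈t = pick 1F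
          z , z∶2 , z∈t = pick 2F
      in x , y , z
         , ((x∶0 , y∶1 , z∶2) , adjacent x∶0 y∶1 (λ ()) x∈t y∈t 
            , adjacent y∶1 z∶2 (λ ()) y∈t z∈t
            , adjacent x∶0 z∶2 (λ ()) x∈t z∈t)
         , good x∈t , good y∈t , good z∈t
      where
      In : Fin n → Set
      In u = a ≡ u ⊎ b ≡ u ⊎ c ≡ u
      good : ∀ {u} → In u → P u
      good (inj₁ refl)        = Pa
      good (inj₂ (inj₁ refl)) = Pb
      good (inj₂ (inj₂ refl)) = Pc
      pick : ∀ d → ∃ λ u → col u ≡ d × In u
      pick d with surjective _ _ _ (proper _ _ a~b) (proper _ _ b~c) (proper _ _ a~c) d
      ... | inj₁ e        = a , e , inj₁ refl
      ... | inj₂ (inj₁ e) = b , e , inj₂ (inj₁ refl)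
      ... | inj₂ (inj₂ e) = c , e , inj₂ (inj₂ refl)
      adjacent : ∀ {u v d d′} → col u ≡ d → col v ≡ d′ → d ≢ d′ → In u → In v → Adj G u v
      adjacent u∶d v∶d′ d≢d′ u∈t v∈t = go u∈t v∈t λ { refl → d≢d′ (trans (sym u∶d) v∶d′) }
        where
        go : ∀ {u v} → In u → In v → u ≢ v → Adj G u v
        go (inj₁ refl)        (inj₁ refl)        u≢v = contradiction refl u≢v
        go (inj₁ refl)        (inj₂ (inj₁ refl)) _   = a~b
        go (inj₁ refl)        (inj₂ (inj₂ refl)) _   = a~c
        go (inj₂ (inj₁ refl)) (inj₁ refl)        _   = symmetric a~b
        go (inj₂ (inj₁ refl)) (inj₂ (inj₁ refl)) u≢v = contradiction refl u≢v
        go (inj₂ (inj₁ refl)) (inj₂ (inj₂ refl)) _   = b~c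
        go (inj₂ (inj₂ refl)) (inj₁ refl)        _   = symmetric a~c
        go (inj₂ (inj₂ refl)) (inj₂ (inj₁ refl)) _   = symmetric b~c
        go (inj₂ (inj₂ refl)) (inj₂ (inj₂ refl)) u≢v = contradiction refl u≢v

    hit-or-avoid : (S : Subset n) → IsHittingSet G S ⊎
      ∃ λ x → ∃ λ y → ∃ λ z → Rainbow x y z × x Subset.∉ S × y Subset.∉ S × z Subset.∉ S
    hit-or-avoid S with Fin.any? (λ x → Fin.any? λ y → Fin.any? λ z →
      rainbow? x y z ×-dec ¬? (x Subset.∈? S) ×-dec ¬? (y Subset.∈? S) ×-dec ¬? (z Subset.∈? S))
    ... | yes avoided = inj₂ avoided
    ... | no  ¬avoided = inj₁ λ a b c t → decidable-stable
            ((a Subset.∈? S) ⊎-dec (b Subset.∈? S) ⊎-dec (c Subset.∈? S))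
            λ missed → ¬avoided (sort (Subset._∉ S) t
              (missed ∘ inj₁) (missed ∘ inj₂ ∘ inj₁) (missed ∘ inj₂ ∘ inj₂))

  -- Criteria for a settled configuration.

  closed⇒settled : ∀ {F : Config m} H rs → length H ≤ 5 → Closed rs F (trianglePools rs F H) → Settled F
  closed⇒settled {F = F} H rs H≤5 closed proper {ρ} E with hit-or-avoid proper (fromList (List.map ρ H))
  ... | inj₁ hit = inj₁ (_ , hit , ℕ.≤-trans (∣fromList∣≤length (List.map ρ H))
                          (subst (_≤ 5) (sym (length-map ρ H)) H≤5))
  ... | inj₂ (x , y , z , ((x∶0 , y∶1 , z∶2) , x~y , y~z , x~z) , x∉ , y∉ , z∉)
    with candidate proper rs H E x∶0 x∉ | candidate proper rs H E y∶1 y∉ | candidate proper rs H E z∶2 z∉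
  ... | inj₁ done | _         | _         = done
  ... | _         | inj₁ done | _         = done
  ... | _         | _         | inj₁ done = done
  ... | inj₂ cx   | inj₂ cy   | inj₂ cz   =
    closed-sound proper closed E ((x~y ∷ x~z ∷ []) ∷ (y~z ∷ []) ∷ [] ∷ []) (cx ∷ cy ∷ cz ∷ [])

  -- The implicit arguments are filled by evaluation, so the type checker runs the search, and it
  -- does so on configurations and reasons alone.
  settle : ∀ {F : Config m} H rs → {True (length H ≤? 5)} →
           {True (closed? rs F (trianglePools rs F H))} → Settled F
  settle H rs {H≤5} {closed} = closed⇒settled H rs (toWitness H≤5) (toWitness closed)

  Unextendable : List Reason → Config m → Set
  Unextendable rs F = ∀ c → All (λ w → Dead rs (F ▹[ c ] w)) (rows F c)

  unextendable? : ∀ rs (F : Config m) → Dec (Unextendable rs F)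
  unextendable? rs F = Fin.all? λ c → All.all? (λ w → dead? rs (F ▹[ c ] w)) (rows F c)

  InSchläfli : Config m → (Fin m → SchV) → Set
  InSchläfli F φ = ∀ i j → edge F i j ≡ schAdj (φ i) (φ j) × (φ i ≡ φ j → i ≡ j)

  inSchläfli? : (F : Config m) → ∀ φ → Dec (InSchläfli F φ)
  inSchläfli? F φ = Fin.all? λ i → Fin.all? λ j →
    (edge F i j Bool.≟ schAdj (φ i) (φ j)) ×-dec (≡-dec Fin._≟_ (≡-dec Fin._≟_ Fin._≟_) (φ i) (φ j) →-dec i Fin.≟ j)

  -- If the embedding is onto, the graph inherits the map into the Schläfli complement; otherwise a
  -- missed vertex gives a dead extension.
  unextendable⇒settled : ∀ {F : Config m} {φ} rs → Unextendable rs F → InSchläfli F φ → Settled F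
  unextendable⇒settled {φ = φ} rs unextendable φ-embeds {col} proper {ρ} E
    with Fin.all? (λ v → Fin.any? λ i → ρ i Fin.≟ v)
  ... | yes onto = inj₂ (φ ∘ proj₁ ∘ onto , inj , edges′)
    where
    inj : ∀ {u v} → φ (proj₁ (onto u)) ≡ φ (proj₁ (onto v)) → u ≡ v
    inj {u} {v} e = trans (sym (proj₂ (onto u))) (trans (cong ρ (proj₂ (φ-embeds _ _) e)) (proj₂ (onto v)))
    edges′ : ∀ u v → adj G u v ≡ schAdj (φ (proj₁ (onto u))) (φ (proj₁ (onto v)))
    edges′ u v = trans (cong₂ (adj G) (sym (proj₂ (onto u))) (sym (proj₂ (onto v))))
                       (trans (edges E _ _) (proj₁ (φ-embeds _ _)))
  ... | no ¬onto with Fin.¬∀⟶∃¬ n _ (λ v → Fin.any? λ i → ρ i Fin.≟ v) ¬onto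
  ...   | v , v∉ρ = dead-sound proper (All.lookup (unextendable (col v)) (row∈rows proper E refl λ i e → v∉ρ (i , e)))
                                      (extend proper E refl λ i e → v∉ρ (i , e))

  settle-schläfli : ∀ {F : Config m} (φ : Vec SchV m) rs → {True (unextendable? rs F)} →
                    {True (inSchläfli? F (lookup (Vec.reverse φ)))} → Settled F
  settle-schläfli {F = F} φ rs {unextendable} {φ-embeds} =
    unextendable⇒settled rs (toWitness unextendable) (toWitness φ-embeds)

  -- Verification of the configurations, each after those it refers to.

  settled₅ : Settled C₅
  settled₅ = settle (List.map vertex (0 ∷ 2 ∷ 5 ∷ 8 ∷ 10 ∷ []))
    (coBridge (0 ∷ 2 ∷ 10 ∷ 9 ∷ 5 ∷ 12 ∷ [])
    ∷ coBridge (1 ∷ 2 ∷ 11 ∷ 5 ∷ 9 ∷ 12 ∷ [])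
    ∷ coBridge (0 ∷ 4 ∷ 3 ∷ 9 ∷ 11 ∷ 12 ∷ [])
    ∷ coBridge (1 ∷ 5 ∷ 7 ∷ 8 ∷ 10 ∷ 12 ∷ [])
    ∷ [])

  settled₁₁ : Settled C₁₁
  settled₁₁ = settle-schläfli
    -- Images of the vertices, oldest first: all nine r and all nine s.
    ((0F , 0F , 0F) ∷ (0F , 1F , 1F) ∷ (0F , 2F , 2F) ∷ (1F , 2F , 0F) ∷ (1F , 0F , 1F) ∷ (1F , 1F , 2F)
    ∷ (0F , 1F , 0F) ∷ (0F , 0F , 1F) ∷ (0F , 2F , 0F) ∷ (0F , 1F , 2F) ∷ (1F , 2F , 2F) ∷ (1F , 1F , 0F)
    ∷ (1F , 2F , 1F) ∷ (1F , 0F , 2F) ∷ (1F , 0F , 0F) ∷ (1F , 1F , 1F) ∷ (0F , 2F , 1F) ∷ (0F , 0F , 2F) ∷ [])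
    (coBridge (0 ∷ 1 ∷ 8 ∷ 4 ∷ 12 ∷ 18 ∷ [])
    ∷ coBridge (0 ∷ 1 ∷ 18 ∷ 16 ∷ 3 ∷ 10 ∷ [])
    ∷ coBridge (0 ∷ 2 ∷ 6 ∷ 18 ∷ 5 ∷ 11 ∷ [])
    ∷ coBridge (0 ∷ 1 ∷ 5 ∷ 16 ∷ 10 ∷ 18 ∷ [])
    ∷ coBridge (0 ∷ 1 ∷ 8 ∷ 18 ∷ 3 ∷ 10 ∷ [])
    ∷ coBridge (0 ∷ 2 ∷ 6 ∷ 4 ∷ 15 ∷ 18 ∷ [])
    ∷ [])

  -- From here back to `C₆`, a triangle missed by the five vertices forces a co-bridge, a failure of
  -- prismaticity, or the next configuration on the way to `C₁₁`.
  settled₁₀ : Settled C₁₀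
  settled₁₀ = settle (List.map vertex (2 ∷ 4 ∷ 9 ∷ 12 ∷ 15 ∷ []))
    (coBridge (1 ∷ 5 ∷ 4 ∷ 11 ∷ 9 ∷ 17 ∷ [])
    ∷ coBridge (0 ∷ 1 ∷ 8 ∷ 4 ∷ 12 ∷ 17 ∷ [])
    ∷ coBridge (0 ∷ 1 ∷ 17 ∷ 16 ∷ 3 ∷ 10 ∷ [])
    ∷ coBridge (0 ∷ 1 ∷ 5 ∷ 16 ∷ 10 ∷ 17 ∷ [])
    ∷ coBridge (0 ∷ 1 ∷ 8 ∷ 17 ∷ 3 ∷ 10 ∷ [])
    ∷ coBridge (0 ∷ 2 ∷ 6 ∷ 4 ∷ 15 ∷ 17 ∷ [])
    ∷ extends settled₁₁
    ∷ [])

  settled₉ : Settled C₉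
  settled₉ = settle (List.map vertex (1 ∷ 4 ∷ 7 ∷ 13 ∷ 14 ∷ []))
    (coBridge (0 ∷ 4 ∷ 3 ∷ 13 ∷ 7 ∷ 16 ∷ [])
    ∷ coBridge (1 ∷ 5 ∷ 4 ∷ 11 ∷ 9 ∷ 16 ∷ [])
    ∷ coBridge (0 ∷ 2 ∷ 3 ∷ 9 ∷ 11 ∷ 16 ∷ [])
    ∷ coBridge (0 ∷ 1 ∷ 8 ∷ 16 ∷ 3 ∷ 10 ∷ [])
    ∷ coBridge (0 ∷ 2 ∷ 6 ∷ 4 ∷ 15 ∷ 16 ∷ [])
    ∷ coBridge (0 ∷ 2 ∷ 16 ∷ 9 ∷ 5 ∷ 11 ∷ [])
    ∷ extends settled₁₀
    ∷ [])

  settled₈ : Settled C₈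
  settled₈ = settle (List.map vertex (0 ∷ 5 ∷ 6 ∷ 8 ∷ 11 ∷ []))
    (coBridge (0 ∷ 2 ∷ 3 ∷ 9 ∷ 11 ∷ 15 ∷ [])
    ∷ coBridge (0 ∷ 4 ∷ 3 ∷ 13 ∷ 7 ∷ 15 ∷ [])
    ∷ coBridge (1 ∷ 5 ∷ 4 ∷ 11 ∷ 9 ∷ 15 ∷ [])
    ∷ coBridge (0 ∷ 1 ∷ 8 ∷ 15 ∷ 3 ∷ 10 ∷ [])
    ∷ coBridge (0 ∷ 2 ∷ 6 ∷ 13 ∷ 5 ∷ 15 ∷ [])
    ∷ coBridge (0 ∷ 2 ∷ 15 ∷ 9 ∷ 5 ∷ 11 ∷ [])
    ∷ extends settled₉
    ∷ [])

  settled₇ : Settled C₇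
  settled₇ = settle (List.map vertex (0 ∷ 3 ∷ 6 ∷ 8 ∷ 11 ∷ []))
    (coBridge (0 ∷ 2 ∷ 3 ∷ 9 ∷ 11 ∷ 14 ∷ [])
    ∷ coBridge (0 ∷ 4 ∷ 3 ∷ 13 ∷ 7 ∷ 14 ∷ [])
    ∷ coBridge (1 ∷ 2 ∷ 7 ∷ 5 ∷ 13 ∷ 14 ∷ [])
    ∷ coBridge (3 ∷ 5 ∷ 12 ∷ 14 ∷ 6 ∷ 8 ∷ [])
    ∷ coBridge (0 ∷ 1 ∷ 8 ∷ 14 ∷ 3 ∷ 10 ∷ [])
    ∷ coBridge (0 ∷ 2 ∷ 14 ∷ 9 ∷ 5 ∷ 11 ∷ [])
    ∷ extends settled₈
    ∷ [])

  settled₆ : Settled C₆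
  settled₆ = settle (List.map vertex (0 ∷ 3 ∷ 6 ∷ 8 ∷ 10 ∷ []))
    (coBridge (1 ∷ 5 ∷ 4 ∷ 11 ∷ 9 ∷ 12 ∷ [])
    ∷ coBridge (0 ∷ 2 ∷ 3 ∷ 9 ∷ 11 ∷ 12 ∷ [])
    ∷ coBridge (3 ∷ 4 ∷ 10 ∷ 9 ∷ 1 ∷ 12 ∷ [])
    ∷ coBridge (0 ∷ 2 ∷ 12 ∷ 9 ∷ 5 ∷ 11 ∷ [])
    ∷ extends settled₇
    -- `C₆` has a symmetry exchanging its triangles 3, 4, 5 and 10, 4, 11, hence a second way to
    -- grow into `C₇`.
    ∷ contains settled₇ unchanged (0 ∷ 1 ∷ 2 ∷ 10 ∷ 4 ∷ 11 ∷ 6 ∷ 7 ∷ 8 ∷ 9 ∷ 3 ∷ 5 ∷ 12 ∷ 13 ∷ [])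
    ∷ [])

  -- As for `C₅` and `C₁₄`, co-bridges and prismaticity rule out every missed triangle, so the five
  -- vertices already hit all triangles.
  settled₁₂ : Settled C₁₂
  settled₁₂ = settle (List.map vertex (0 ∷ 3 ∷ 7 ∷ 8 ∷ 10 ∷ []))
    (coBridge (0 ∷ 9 ∷ 3 ∷ 11 ∷ 6 ∷ 12 ∷ [])
    ∷ coBridge (1 ∷ 8 ∷ 7 ∷ 10 ∷ 3 ∷ 12 ∷ [])
    ∷ coBridge (0 ∷ 2 ∷ 3 ∷ 12 ∷ 8 ∷ 10 ∷ [])
    ∷ coBridge (3 ∷ 9 ∷ 7 ∷ 11 ∷ 1 ∷ 12 ∷ [])
    ∷ [])

  settled₁₃ : Settled C₁₃
  settled₁₃ = settle (List.map vertex (0 ∷ 3 ∷ 6 ∷ 8 ∷ 10 ∷ []))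
    (coBridge (0 ∷ 1 ∷ 8 ∷ 4 ∷ 10 ∷ 13 ∷ [])
    ∷ coBridge (0 ∷ 2 ∷ 3 ∷ 9 ∷ 12 ∷ 13 ∷ [])
    ∷ coBridge (1 ∷ 2 ∷ 7 ∷ 5 ∷ 11 ∷ 13 ∷ [])
    ∷ coBridge (3 ∷ 5 ∷ 10 ∷ 13 ∷ 6 ∷ 8 ∷ [])
    ∷ coBridge (3 ∷ 9 ∷ 10 ∷ 11 ∷ 1 ∷ 13 ∷ [])
    ∷ coBridge (0 ∷ 2 ∷ 13 ∷ 9 ∷ 5 ∷ 12 ∷ [])
    -- The first new vertex, of age 13, and vertex 12 complete `C₄` to `C₆`.
    ∷ contains settled₆ unchanged (0 ∷ 1 ∷ 2 ∷ 3 ∷ 4 ∷ 5 ∷ 6 ∷ 7 ∷ 8 ∷ 9 ∷ 13 ∷ 12 ∷ [])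
    ∷ [])

  settled₁₄ : Settled C₁₄
  settled₁₄ = settle (List.map vertex (0 ∷ 3 ∷ 6 ∷ 8 ∷ 10 ∷ []))
    (coBridge (0 ∷ 1 ∷ 8 ∷ 4 ∷ 11 ∷ 13 ∷ [])
    ∷ coBridge (0 ∷ 2 ∷ 3 ∷ 9 ∷ 10 ∷ 13 ∷ [])
    ∷ coBridge (1 ∷ 2 ∷ 7 ∷ 5 ∷ 12 ∷ 13 ∷ [])
    ∷ coBridge (3 ∷ 5 ∷ 11 ∷ 13 ∷ 6 ∷ 8 ∷ [])
    ∷ coBridge (3 ∷ 9 ∷ 11 ∷ 12 ∷ 1 ∷ 13 ∷ [])
    ∷ coBridge (0 ∷ 2 ∷ 13 ∷ 9 ∷ 5 ∷ 10 ∷ [])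
    ∷ [])

  settled₄ : Settled C₄
  settled₄ = settle (List.map vertex (0 ∷ 3 ∷ 5 ∷ 6 ∷ 8 ∷ []))
    (coBridge (1 ∷ 5 ∷ 11 ∷ 10 ∷ 6 ∷ 9 ∷ [])
    ∷ coBridge (3 ∷ 4 ∷ 10 ∷ 11 ∷ 1 ∷ 7 ∷ [])
    ∷ coBridge (4 ∷ 5 ∷ 11 ∷ 10 ∷ 2 ∷ 9 ∷ [])
    ∷ extends settled₆
    ∷ extends settled₅
    ∷ extends settled₁₂
    ∷ extends settled₁₃
    ∷ extends settled₁₄
    -- The new triangle can also exchange roles with the triangle 3, 4, 5.
    ∷ contains settled₁₃ unchanged (0 ∷ 1 ∷ 2 ∷ 10 ∷ 11 ∷ 12 ∷ 6 ∷ 7 ∷ 8 ∷ 9 ∷ 3 ∷ 4 ∷ 5 ∷ [])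
    ∷ [])

  settled₁₅ : Settled C₁₅
  settled₁₅ = settle (List.map vertex (2 ∷ 4 ∷ 7 ∷ 9 ∷ 10 ∷ []))
    (coBridge (1 ∷ 2 ∷ 7 ∷ 10 ∷ 4 ∷ 11 ∷ [])
    ∷ coBridge (0 ∷ 2 ∷ 6 ∷ 4 ∷ 10 ∷ 11 ∷ [])
    ∷ coBridge (0 ∷ 4 ∷ 8 ∷ 9 ∷ 7 ∷ 11 ∷ [])
    ∷ coBridge (0 ∷ 1 ∷ 11 ∷ 12 ∷ 3 ∷ 8 ∷ [])
    ∷ coBridge (1 ∷ 5 ∷ 3 ∷ 10 ∷ 6 ∷ 11 ∷ [])
    ∷ contains settled₄ unchanged (6 ∷ 7 ∷ 2 ∷ 3 ∷ 4 ∷ 5 ∷ 0 ∷ 1 ∷ 11 ∷ 12 ∷ [])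
    ∷ contains settled₄ (0F ∷ 2F ∷ 1F ∷ []) (3 ∷ 5 ∷ 4 ∷ 0 ∷ 2 ∷ 1 ∷ 8 ∷ 13 ∷ 11 ∷ 12 ∷ [])
    ∷ contains settled₄ (2F ∷ 0F ∷ 1F ∷ []) (11 ∷ 12 ∷ 0 ∷ 4 ∷ 5 ∷ 3 ∷ 1 ∷ 2 ∷ 7 ∷ 6 ∷ [])
    ∷ contains settled₄ (2F ∷ 0F ∷ 1F ∷ []) (11 ∷ 12 ∷ 6 ∷ 4 ∷ 5 ∷ 3 ∷ 7 ∷ 2 ∷ 1 ∷ 0 ∷ [])
    ∷ [])

  settled₁₆ : Settled C₁₆
  settled₁₆ = settle (List.map vertex (0 ∷ 5 ∷ 6 ∷ 8 ∷ 10 ∷ []))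
    (coBridge (0 ∷ 2 ∷ 6 ∷ 10 ∷ 5 ∷ 11 ∷ [])
    ∷ coBridge (1 ∷ 2 ∷ 7 ∷ 5 ∷ 10 ∷ 11 ∷ [])
    ∷ coBridge (0 ∷ 1 ∷ 11 ∷ 12 ∷ 3 ∷ 9 ∷ [])
    ∷ coBridge (0 ∷ 4 ∷ 3 ∷ 10 ∷ 7 ∷ 11 ∷ [])
    ∷ coBridge (1 ∷ 5 ∷ 9 ∷ 8 ∷ 6 ∷ 11 ∷ [])
    ∷ contains settled₄ unchanged (0 ∷ 1 ∷ 2 ∷ 3 ∷ 4 ∷ 5 ∷ 6 ∷ 7 ∷ 11 ∷ 12 ∷ [])
    ∷ contains settled₄ unchanged (0 ∷ 1 ∷ 2 ∷ 3 ∷ 4 ∷ 5 ∷ 11 ∷ 9 ∷ 8 ∷ 10 ∷ [])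
    ∷ contains settled₄ unchanged (6 ∷ 7 ∷ 2 ∷ 3 ∷ 4 ∷ 5 ∷ 0 ∷ 1 ∷ 11 ∷ 12 ∷ [])
    ∷ contains settled₄ (1F ∷ 0F ∷ 2F ∷ []) (1 ∷ 0 ∷ 2 ∷ 9 ∷ 8 ∷ 10 ∷ 11 ∷ 3 ∷ 4 ∷ 5 ∷ [])
    ∷ [])

  settled₃ : Settled C₃
  settled₃ = settle (List.map vertex (1 ∷ 2 ∷ 3 ∷ 4 ∷ 5 ∷ []))
    (coBridge (3 ∷ 4 ∷ 8 ∷ 9 ∷ 1 ∷ 7 ∷ [])
    ∷ extends settled₄
    ∷ extends settled₁₅
    ∷ extends settled₁₆
    ∷ contains settled₁₅ unchanged (0 ∷ 1 ∷ 2 ∷ 8 ∷ 9 ∷ 10 ∷ 6 ∷ 7 ∷ 3 ∷ 4 ∷ 5 ∷ [])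
    ∷ contains settled₄ (2F ∷ 0F ∷ 1F ∷ []) (8 ∷ 9 ∷ 0 ∷ 4 ∷ 5 ∷ 3 ∷ 1 ∷ 2 ∷ 7 ∷ 6 ∷ [])
    ∷ contains settled₄ (2F ∷ 0F ∷ 1F ∷ []) (8 ∷ 9 ∷ 6 ∷ 4 ∷ 5 ∷ 3 ∷ 7 ∷ 2 ∷ 1 ∷ 0 ∷ [])
    ∷ [])

  settled₁₈ : Settled C₁₈
  settled₁₈ = settle (List.map vertex (1 ∷ 2 ∷ 4 ∷ 7 ∷ 11 ∷ []))
    (coBridge (0 ∷ 1 ∷ 9 ∷ 7 ∷ 3 ∷ 12 ∷ [])
    ∷ coBridge (0 ∷ 2 ∷ 6 ∷ 11 ∷ 5 ∷ 12 ∷ [])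
    ∷ coBridge (1 ∷ 2 ∷ 10 ∷ 8 ∷ 4 ∷ 12 ∷ [])
    ∷ coBridge (3 ∷ 4 ∷ 6 ∷ 11 ∷ 1 ∷ 12 ∷ [])
    ∷ coBridge (3 ∷ 5 ∷ 10 ∷ 8 ∷ 0 ∷ 12 ∷ [])
    ∷ coBridge (4 ∷ 5 ∷ 7 ∷ 9 ∷ 2 ∷ 12 ∷ [])
    ∷ contains settled₃ unchanged (0 ∷ 1 ∷ 2 ∷ 3 ∷ 4 ∷ 5 ∷ 6 ∷ 13 ∷ [])
    ∷ contains settled₃ unchanged (0 ∷ 1 ∷ 2 ∷ 3 ∷ 4 ∷ 5 ∷ 12 ∷ 10 ∷ [])
    ∷ contains settled₃ (0F ∷ 2F ∷ 1F ∷ []) (3 ∷ 5 ∷ 4 ∷ 0 ∷ 2 ∷ 1 ∷ 6 ∷ 14 ∷ [])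
    ∷ contains settled₃ (2F ∷ 1F ∷ 0F ∷ []) (5 ∷ 4 ∷ 3 ∷ 2 ∷ 1 ∷ 0 ∷ 8 ∷ 12 ∷ [])
    ∷ [])

  settled₁₇ : Settled C₁₇
  settled₁₇ = settle (List.map vertex (1 ∷ 3 ∷ 5 ∷ 6 ∷ 7 ∷ []))
    (coBridge (0 ∷ 1 ∷ 9 ∷ 10 ∷ 3 ∷ 6 ∷ [])
    ∷ coBridge (0 ∷ 2 ∷ 9 ∷ 10 ∷ 5 ∷ 8 ∷ [])
    ∷ coBridge (3 ∷ 4 ∷ 9 ∷ 10 ∷ 1 ∷ 7 ∷ [])
    ∷ coBridge (4 ∷ 5 ∷ 10 ∷ 9 ∷ 2 ∷ 8 ∷ [])
    ∷ coBridge (6 ∷ 7 ∷ 9 ∷ 10 ∷ 1 ∷ 3 ∷ [])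
    ∷ extends settled₁₈
    ∷ contains settled₃ unchanged (0 ∷ 1 ∷ 2 ∷ 3 ∷ 4 ∷ 5 ∷ 6 ∷ 10 ∷ [])
    ∷ contains settled₃ unchanged (0 ∷ 1 ∷ 2 ∷ 3 ∷ 4 ∷ 5 ∷ 9 ∷ 10 ∷ [])
    ∷ contains settled₃ unchanged (6 ∷ 7 ∷ 8 ∷ 3 ∷ 4 ∷ 5 ∷ 9 ∷ 10 ∷ [])
    -- With `extends settled₁₈`, these three entries put a fourth disjoint triangle at each of the
    -- four places in the transitive order.
    ∷ contains settled₁₈ unchanged (6 ∷ 7 ∷ 8 ∷ 3 ∷ 4 ∷ 5 ∷ 9 ∷ 10 ∷ 11 ∷ 0 ∷ 1 ∷ 2 ∷ [])
    ∷ contains settled₁₈ unchanged (6 ∷ 7 ∷ 8 ∷ 9 ∷ 10 ∷ 11 ∷ 3 ∷ 4 ∷ 5 ∷ 0 ∷ 1 ∷ 2 ∷ [])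
    ∷ contains settled₁₈ unchanged (9 ∷ 10 ∷ 11 ∷ 3 ∷ 4 ∷ 5 ∷ 6 ∷ 7 ∷ 8 ∷ 0 ∷ 1 ∷ 2 ∷ [])
    ∷ contains settled₃ (2F ∷ 0F ∷ 1F ∷ []) (1 ∷ 2 ∷ 0 ∷ 4 ∷ 5 ∷ 3 ∷ 9 ∷ 10 ∷ [])
    ∷ contains settled₃ (0F ∷ 2F ∷ 1F ∷ []) (3 ∷ 5 ∷ 4 ∷ 0 ∷ 2 ∷ 1 ∷ 6 ∷ 11 ∷ [])
    ∷ contains settled₃ (0F ∷ 2F ∷ 1F ∷ []) (3 ∷ 5 ∷ 4 ∷ 0 ∷ 2 ∷ 1 ∷ 9 ∷ 10 ∷ [])
    ∷ [])

  settled₁₉ : Settled C₁₉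
  settled₁₉ = settle (List.map vertex (0 ∷ 2 ∷ 5 ∷ 7 ∷ 8 ∷ []))
    (contains settled₃ unchanged (0 ∷ 1 ∷ 2 ∷ 9 ∷ 10 ∷ 11 ∷ 3 ∷ 7 ∷ [])
    ∷ contains settled₁₇ unchanged (9 ∷ 10 ∷ 11 ∷ 0 ∷ 1 ∷ 2 ∷ 6 ∷ 7 ∷ 8 ∷ [])
    ∷ [])

  settled₂ : Settled C₂
  -- Only vertex 2 is left out. A missed triangle through it forces `C₃`; one disjoint from the
  -- prism gives a tournament, `C₁₇` or `C₁₉`.
  settled₂ = settle (List.map vertex (0 ∷ 1 ∷ 3 ∷ 4 ∷ 5 ∷ []))
    (extends settled₃
    ∷ extends settled₁₇
    ∷ extends settled₁₉
    -- The two other places of the new triangle in the transitive order.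
    ∷ contains settled₁₇ unchanged (0 ∷ 1 ∷ 2 ∷ 6 ∷ 7 ∷ 8 ∷ 3 ∷ 4 ∷ 5 ∷ [])
    ∷ contains settled₁₇ unchanged (6 ∷ 7 ∷ 8 ∷ 3 ∷ 4 ∷ 5 ∷ 0 ∷ 1 ∷ 2 ∷ [])
    ∷ [])

  settled₁ : Settled C₁
  settled₁ = settle (List.map vertex (0 ∷ 1 ∷ 2 ∷ []))
    (extends settled₂
    -- The opposite colour shift becomes `C₂` when the two triangles change roles.
    ∷ contains settled₂ unchanged (3 ∷ 4 ∷ 5 ∷ 0 ∷ 1 ∷ 2 ∷ [])
    ∷ [])

  settled₀ : Settled ∅
  -- Either there is no triangle and the empty set hits all, or some triangle is a copy of `C₁`.
  settled₀ = settle [] (extends settled₁ ∷ [])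

theorem4p1 : {n : ℕ} (G : Graph n) → ThreeColorable G → CoBridgeFree G → Prismatic G →
    ΛAtMost G 5 ⊎ SchlafliPrismatic G
theorem4p1 G (col , proper) coBridgeFree prismatic =
  settled₀ G coBridgeFree prismatic proper (empty G coBridgeFree prismatic proper)
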